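{- For every integer $n\ge 0$, \[ \overline{p}_o(2n+1)=2\sum_{k=0}^{\infty}\overline{p}\bigl(n-2k(k+1)\bigr). \]
   Context: An overpartition of $n$ is a partition of $n$ in which the first occurrence of each part size may be overlined. $\overline{p}(n)$ is the number of overpartitions of $n$, with $\sum_{n\ge0}\overline{p}(n)q^n=\frac{(-q;q)_\infty}{(q;q)_\infty}$; $\overline{p}_o(n)$ is the number of overpartitions of $n$ into odd parts, with $\sum_{n\ge0}\overline{p}_o(n)q^n=\frac{(-q;q^2)_\infty}{(q;q^2)_\infty}$, where $(a;q)_\infty=\prod_{k\ge1}(1-aq^{k-1})$. Convention: $\overline{p}(x)=0$ whenever $x$ is not a nonnegative integer. -}

module Defs where

open import Data.Nat using (ℕ; zero; suc; _+_; _*_; _∸_; _≡ᵇ_; _≤ᵇ_; _<ᵇ_; _%_)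
open import Data.Bool using (Bool; true; false; _∧_; _∨_; not; if_then_else_)
open import Data.Product using (_×_; _,_)
open import Data.List using (List; []; _∷_; map; concatMap; applyUpTo; filterᵇ; length; upTo)
open import Data.Nat.ListAction using (sum)

-- A marked part: (size , overlined?)
Part : Set
Part = ℕ × Bool

-- An overpartition is represented as the list of its parts written in
-- nonincreasing order, each part carrying a flag saying whether it is
-- overlined.  Since equal parts are contiguous, "only the first occurrence of
-- a part size may be overlined" means: an element whose size equals that of
-- its predecessor is not overlined.

allPos : List Part → Bool
allPos []            = true
allPos ((a , _) ∷ l) = (0 <ᵇ a) ∧ allPos l

wellOrdered : List Part → Bool
wellOrdered []                          = true
wellOrdered (_ ∷ [])                    = true
wellOrdered ((a , _) ∷ (b , f) ∷ l)     =
  (b ≤ᵇ a) ∧ (not (a ≡ᵇ b) ∨ not f) ∧ wellOrdered ((b , f) ∷ l)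

isOverpartition : List Part → Bool
isOverpartition l = allPos l ∧ wellOrdered l

allOdd : List Part → Bool
allOdd []            = true
allOdd ((a , _) ∷ l) = (a % 2 ≡ᵇ 1) ∧ allOdd l

-- candidates fuel n : every list of marked positive parts (a composition of n
-- with arbitrary flags), each exactly once, provided fuel ≥ n.
candidates : ℕ → ℕ → List (List Part)
candidates _        zero    = [] ∷ []
candidates zero     (suc _) = []
candidates (suc f)  (suc n) =
  concatMap (λ k → concatMap (λ b → map ((k , b) ∷_) (candidates f (suc n ∸ k)))
                              (true ∷ false ∷ []))
            (applyUpTo suc (suc n))

overpartitions : ℕ → List (List Part)
overpartitions n = filterᵇ isOverpartition (candidates n n)

pbar : ℕ → ℕ
pbar n = length (overpartitions n)

pbarOdd : ℕ → ℕ
pbarOdd n = length (filterᵇ allOdd (overpartitions n))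

pbarSub : ℕ → ℕ → ℕ
pbarSub n m = if m ≤ᵇ n then pbar (n ∸ m) else 0

-- Σ_{k ≥ 0} p̄(n − 2k(k+1)); terms with k > n vanish since 2k(k+1) > n,
-- so the sum over k = 0 .. n is the full infinite sum.
thetaSum : ℕ → ℕ
thetaSum n = sum (map (λ k → pbarSub n (2 * k * (k + 1))) (upTo (suc n)))

{-# OPTIONS --safe #-}

-- With Q = q², the odd-part generating function O and the full one P satisfy
-- O(q) = (Σ_{j∈ℤ} q^(j²)) P(Q); comparing coefficients of q^(2n+1) leaves the odd
-- j = ±(2k+1), for which j² = 2·2k(k+1) + 1.
--
-- The product formula is obtained from a finite version.  Pascal's rule for Gaussian
-- binomials gives ∏_{k<N} (1 + q^(2k+1))² = Σ_{r+s=2N} q^((r−N)²) [2N, r]_Q, and clearing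
-- denominators yields O_N / (Q²;Q²)_N = Σ_{r+s=2N} q^((r−N)²) / ((Q)_r (Q)_s).  Modulo
-- q^(2N+1) both (Q)_r and (Q)_s may be replaced by (Q)_N, and 1 / (Q)_N² is
-- P_N(Q) / (Q²;Q²)_N.
--
-- Every series has coefficients in ℕ: division by 1 − q^k is expressed by the fact that
-- h = c + q^k h has a unique solution h.
module Submission where

open import Defs
open import Algebra.Bundles using (CommutativeSemiring)
import Algebra.Solver.CommutativeMonoid as CommutativeMonoidSolver
import Algebra.Solver.Ring.NaturalCoefficients.Default as NaturalCoefficients
open import Algebra.Structures.Biased using (isCommutativeMonoidˡ; isCommutativeSemiringˡ)
open import Data.Bool using (Bool; true; false; _∧_; _∨_; not; if_then_else_)
open import Data.Bool.Properties using (∧-identityʳ; ∧-commutativeMonoid)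
open import Data.List using (List; []; _∷_; _++_; map; concatMap; applyUpTo; filterᵇ; length)
open import Data.List.Properties using (applyUpTo-∷ʳ; map-upTo)
open import Data.Nat
open import Data.Nat.ListAction using (sum)
open import Data.Nat.ListAction.Properties using (sum-++)
open import Data.Nat.Properties
open import Data.Nat.Tactic.RingSolver using (solve-∀)
open import Data.Product using (_,_)
open import Data.Sum using (inj₁; inj₂)
open import Level using (0ℓ)
open import Relation.Binary.Bundles using (Setoid)
open import Relation.Binary.PropositionalEquality hiding (setoid)
import Relation.Binary.Reasoning.Setoid as SetoidReasoning
open import Relation.Binary.Structures using (IsEquivalence)

-- Over ℕ the polynomial (Q)_r cannot be written, only its inverse. Gaussian binomials therefore
-- enter through the linear functional `gaussSum`, and become explicit only after multiplication by
-- `invPoch`. Replacing (Q)_r and (Q)_s by (Q)_N is safe because two effects balance: with d = |r -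
-- N| the reciprocals agree modulo q^(2(N - d + 1)), and the factor q^(d²) makes up for the loss, as
-- d² - 2d + 2 ≥ 1. The combinatorial side rests on one observation: what may follow a part k is the
-- same whether or not that k is overlined, since every further k must be unmarked. Lists can thus
-- be counted by their head, each permitted head size of the whole list counts twice, and the
-- factors (1 + q^k)/(1 - q^k) result.

-- Formal power series over ℕ

-- Without η, series are compared by their heads instead of being unfolded coefficientwise.
record Series : Set where
  no-eta-equality
  constructor series
  field coeff : ℕ → ℕ
open Series

infix 4 _≈_
record _≈_ (X Y : Series) : Set where
  constructor pointwise
  field at : ∀ n → coeff X n ≡ coeff Y n
open _≈_

infixl 6 _⊕_
infixl 7 _⊗_

shift : Series → Series
coeff (shift X) zero    = 0
coeff (shift X) (suc n) = coeff X n

mono : ℕ → Series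
coeff (mono zero) zero    = 1
coeff (mono zero) (suc n) = 0
mono (suc k) = shift (mono k)

𝟘 𝟙 : Series
coeff 𝟘 n = 0
𝟙 = mono 0

_⊕_ : Series → Series → Series
coeff (X ⊕ Y) n = coeff X n + coeff Y n

-- Recursion on the first factor, rather than a sum over indices, makes `shift` pass through a
-- product by computation.
cauchy : (ℕ → ℕ) → (ℕ → ℕ) → ℕ → ℕ
cauchy f g zero    = f 0 * g 0
cauchy f g (suc n) = f 0 * g (suc n) + cauchy (λ i → f (suc i)) g n

_⊗_ : Series → Series → Series
coeff (X ⊗ Y) = cauchy (coeff X) (coeff Y)

cauchy-cong≤ : ∀ {f f′ g g′} n → (∀ i → i ≤ n → f i ≡ f′ i) → (∀ i → i ≤ n → g i ≡ g′ i) →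
               cauchy f g n ≡ cauchy f′ g′ n
cauchy-cong≤ zero    p r = cong₂ _*_ (p 0 z≤n) (r 0 z≤n)
cauchy-cong≤ (suc n) p r = cong₂ _+_ (cong₂ _*_ (p 0 z≤n) (r (suc n) ≤-refl))
  (cauchy-cong≤ n (λ i i≤n → p (suc i) (s≤s i≤n)) (λ i i≤n → r i (m≤n⇒m≤1+n i≤n)))

cauchy-cong : ∀ {f f′ g g′} n → (∀ i → f i ≡ f′ i) → (∀ i → g i ≡ g′ i) →
              cauchy f g n ≡ cauchy f′ g′ n
cauchy-cong n p r = cauchy-cong≤ n (λ i _ → p i) (λ i _ → r i)

cauchy-zeroˡ : ∀ g n → cauchy (λ _ → 0) g n ≡ 0
cauchy-zeroˡ g zero    = refl
cauchy-zeroˡ g (suc n) = cauchy-zeroˡ g n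

-- `cauchy` peels off the head of `f`; commutativity requires peeling off the head of `g` as well.
cauchy-lastʳ : ∀ f g n → cauchy f g (suc n) ≡ f (suc n) * g 0 + cauchy f (λ i → g (suc i)) n
cauchy-lastʳ f g zero    = +-comm (f 0 * g 1) (f 1 * g 0)
cauchy-lastʳ f g (suc n) = begin
  a + cauchy f⁺ g (suc n)                              ≡⟨ cong (a +_) (cauchy-lastʳ f⁺ g n) ⟩
  a + (b + cauchy f⁺ (λ i → g (suc i)) n)              ≡⟨ +-assoc a b _ ⟨
  a + b + cauchy f⁺ (λ i → g (suc i)) n                ≡⟨ cong (_+ c) (+-comm a b) ⟩
  b + a + cauchy f⁺ (λ i → g (suc i)) n                ≡⟨ +-assoc b a _ ⟩
  b + (a + cauchy f⁺ (λ i → g (suc i)) n)              ∎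
  where
  open ≡-Reasoning
  f⁺ = λ i → f (suc i)
  a = f 0 * g (suc (suc n))
  b = f (suc (suc n)) * g 0
  c = cauchy f⁺ (λ i → g (suc i)) n

cauchy-comm : ∀ f g n → cauchy f g n ≡ cauchy g f n
cauchy-comm f g zero    = *-comm (f 0) (g 0)
cauchy-comm f g (suc n) = trans
  (cong₂ _+_ (*-comm (f 0) (g (suc n))) (cauchy-comm (λ i → f (suc i)) g n))
  (sym (cauchy-lastʳ g f n))

cauchy-distribʳ : ∀ h f g n → cauchy (λ i → f i + g i) h n ≡ cauchy f h n + cauchy g h n
cauchy-distribʳ h f g zero    = *-distribʳ-+ (h 0) (f 0) (g 0)
cauchy-distribʳ h f g (suc n) = trans
  (cong₂ _+_ (*-distribʳ-+ (h (suc n)) (f 0) (g 0)) (cauchy-distribʳ h _ _ n))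
  (interchange (f 0 * h (suc n)) (g 0 * h (suc n)) _ _)
  where
  interchange : ∀ a b c d → a + b + (c + d) ≡ a + c + (b + d)
  interchange = solve-∀

cauchy-scaleˡ : ∀ c f g n → cauchy (λ i → c * f i) g n ≡ c * cauchy f g n
cauchy-scaleˡ c f g zero    = *-assoc c (f 0) (g 0)
cauchy-scaleˡ c f g (suc n) = trans
  (cong₂ _+_ (*-assoc c (f 0) (g (suc n))) (cauchy-scaleˡ c _ g n))
  (sym (*-distribˡ-+ c _ _))

cauchy-assoc : ∀ f g h n → cauchy (cauchy f g) h n ≡ cauchy f (cauchy g h) n
cauchy-assoc f g h zero    = *-assoc (f 0) (g 0) (h 0)
cauchy-assoc f g h (suc n) = begin
  f 0 * g 0 * h (suc n) + cauchy (λ i → f 0 * g (suc i) + cauchy f⁺ g i) h n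
    ≡⟨ cong₂ _+_ (*-assoc (f 0) (g 0) _) (cauchy-distribʳ h _ _ n) ⟩
  f 0 * (g 0 * h (suc n)) + (cauchy (λ i → f 0 * g (suc i)) h n + cauchy (cauchy f⁺ g) h n)
    ≡⟨ cong (f 0 * (g 0 * h (suc n)) +_)
         (cong₂ _+_ (cauchy-scaleˡ (f 0) _ h n) (cauchy-assoc f⁺ g h n)) ⟩
  f 0 * (g 0 * h (suc n)) + (f 0 * cauchy (λ i → g (suc i)) h n + cauchy f⁺ (cauchy g h) n)
    ≡⟨ +-assoc (f 0 * (g 0 * h (suc n))) _ _ ⟨
  f 0 * (g 0 * h (suc n)) + f 0 * cauchy (λ i → g (suc i)) h n + cauchy f⁺ (cauchy g h) n
    ≡⟨ cong (_+ cauchy f⁺ (cauchy g h) n) (*-distribˡ-+ (f 0) _ _) ⟨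
  f 0 * cauchy g h (suc n) + cauchy f⁺ (cauchy g h) n ∎
  where
  open ≡-Reasoning
  f⁺ = λ i → f (suc i)

𝟙-identityˡ : ∀ X → 𝟙 ⊗ X ≈ X
at (𝟙-identityˡ X) zero    = +-identityʳ (coeff X 0)
at (𝟙-identityˡ X) (suc n) = trans
  (cong (1 * coeff X (suc n) +_) (cauchy-zeroˡ (coeff X) n))
  (trans (+-identityʳ _) (+-identityʳ _))

seriesSemiring : CommutativeSemiring 0ℓ 0ℓ
seriesSemiring = record
  { Carrier = Series ; _≈_ = _≈_ ; _+_ = _⊕_ ; _*_ = _⊗_ ; 0# = 𝟘 ; 1# = 𝟙
  ; isCommutativeSemiring = isCommutativeSemiringˡ record
    { +-isCommutativeMonoid = record
      { isMonoid = record
        { isSemigroup = record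
          { isMagma = record
            { isEquivalence = isEquivalence′
            ; ∙-cong = λ p r → pointwise λ n → cong₂ _+_ (at p n) (at r n) }
          ; assoc = λ X Y Z → pointwise λ n → +-assoc (coeff X n) _ _ }
        ; identity = (λ X → pointwise λ n → refl)
                   , (λ X → pointwise λ n → +-identityʳ _) }
      ; comm = λ X Y → pointwise λ n → +-comm (coeff X n) _ }
    ; *-isCommutativeMonoid = isCommutativeMonoidˡ record
      { isSemigroup = record
        { isMagma = record
          { isEquivalence = isEquivalence′
          ; ∙-cong = λ p r → pointwise λ n → cauchy-cong n (at p) (at r) }
        ; assoc = λ X Y Z → pointwise (cauchy-assoc (coeff X) (coeff Y) (coeff Z)) }
      ; identityˡ = 𝟙-identityˡ
      ; comm = λ X Y → pointwise (cauchy-comm (coeff X) (coeff Y)) }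
    ; distribʳ = λ X Y Z → pointwise (cauchy-distribʳ (coeff X) (coeff Y) (coeff Z))
    ; zeroˡ = λ X → pointwise (cauchy-zeroˡ (coeff X))
    }
  }
  where
  isEquivalence′ : IsEquivalence _≈_
  isEquivalence′ = record
    { refl  = pointwise λ _ → refl
    ; sym   = λ p → pointwise λ n → sym (at p n)
    ; trans = λ p r → pointwise λ n → trans (at p n) (at r n) }

open CommutativeSemiring seriesSemiring using (setoid)
  renaming ( refl to ≈-refl; sym to ≈-sym; trans to ≈-trans; reflexive to ≈-reflexive
           ; +-cong to ⊕-cong; +-congˡ to ⊕-congˡ; +-congʳ to ⊕-congʳ
           ; +-assoc to ⊕-assoc; +-comm to ⊕-comm
           ; +-identityˡ to ⊕-identityˡ; +-identityʳ to ⊕-identityʳ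
           ; *-cong to ⊗-cong; *-congˡ to ⊗-congˡ; *-congʳ to ⊗-congʳ
           ; *-assoc to ⊗-assoc; *-comm to ⊗-comm; *-identityʳ to ⊗-identityʳ
           ; zeroˡ to ⊗-zeroˡ; zeroʳ to ⊗-zeroʳ; distribʳ to ⊗-distribʳ-⊕ )
module ≈-Reasoning = SetoidReasoning setoid
open NaturalCoefficients seriesSemiring using (solve; _:=_; _:+_; _:*_; con)
open CommutativeMonoidSolver ∧-commutativeMonoid using (_⊜_)
  renaming (solve to solve∧; _⊕_ to _⊹_; id to 𝟏)

shift-⊗ : ∀ X Y → shift X ⊗ Y ≈ shift (X ⊗ Y)
at (shift-⊗ X Y) zero    = refl
at (shift-⊗ X Y) (suc n) = refl

shift-cong : ∀ {X Y} → X ≈ Y → shift X ≈ shift Y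
at (shift-cong p) zero    = refl
at (shift-cong p) (suc n) = at p n

mono-+ : ∀ m n → mono (m + n) ≈ mono m ⊗ mono n
mono-+ zero    n = ≈-sym (𝟙-identityˡ (mono n))
mono-+ (suc m) n = ≈-trans (shift-cong (mono-+ m n)) (≈-sym (shift-⊗ (mono m) (mono n)))

coeff-mono-≥ : ∀ e X n → coeff (mono e ⊗ X) (e + n) ≡ coeff X n
coeff-mono-≥ zero    X n = at (𝟙-identityˡ X) n
coeff-mono-≥ (suc e) X n = coeff-mono-≥ e X n

coeff-mono-< : ∀ {e n} X → n < e → coeff (mono e ⊗ X) n ≡ 0
coeff-mono-< {suc e} {zero}  X n<e       = refl
coeff-mono-< {suc e} {suc n} X (s≤s n<e) = coeff-mono-< {e} X n<e

-- Truncated congruence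

infix 4 _≈[_]_
record _≈[_]_ (X : Series) (m : ℕ) (Y : Series) : Set where
  constructor below
  field at< : ∀ i → i < m → coeff X i ≡ coeff Y i
open _≈[_]_

truncSetoid : ℕ → Setoid 0ℓ 0ℓ
truncSetoid m = record
  { Carrier = Series ; _≈_ = _≈[ m ]_
  ; isEquivalence = record
    { refl  = below λ _ _ → refl
    ; sym   = λ p → below λ i l → sym (at< p i l)
    ; trans = λ p r → below λ i l → trans (at< p i l) (at< r i l) } }

module Trunc {m} = Setoid (truncSetoid m)

≈⇒≈[] : ∀ {X Y m} → X ≈ Y → X ≈[ m ] Y
≈⇒≈[] p = below λ i _ → at p i

≈[]-weaken : ∀ {X Y m n} → m ≤ n → X ≈[ n ] Y → X ≈[ m ] Y
≈[]-weaken m≤n p = below λ i l → at< p i (<-≤-trans l m≤n)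

⊕-cong[] : ∀ {X X′ Y Y′ m} → X ≈[ m ] X′ → Y ≈[ m ] Y′ → X ⊕ Y ≈[ m ] X′ ⊕ Y′
⊕-cong[] p r = below λ i l → cong₂ _+_ (at< p i l) (at< r i l)

⊗-cong[] : ∀ {X X′ Y Y′ m} → X ≈[ m ] X′ → Y ≈[ m ] Y′ → X ⊗ Y ≈[ m ] X′ ⊗ Y′
⊗-cong[] p r = below λ i l → cauchy-cong≤ i
  (λ j j≤i → at< p j (≤-<-trans j≤i l)) (λ j j≤i → at< r j (≤-<-trans j≤i l))

-- The factor q^k moves every coefficient up by k, so precision grows. This gain drives
-- `recurrence-unique` and the error estimate in `oddOver≈theta`.
mono-≈[] : ∀ {X Y m} k → X ≈[ m ] Y → mono k ⊗ X ≈[ k + m ] mono k ⊗ Y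
mono-≈[] {X} {Y} zero p =
  Trunc.trans (≈⇒≈[] (𝟙-identityˡ X)) (Trunc.trans p (≈⇒≈[] (≈-sym (𝟙-identityˡ Y))))
mono-≈[] {X} {Y} {m} (suc k) p = below λ
  { zero    _       → refl
  ; (suc i) (s≤s l) → at< (mono-≈[] k p) i l }

mono≈[]𝟘 : ∀ {m} k X → m ≤ k → mono k ⊗ X ≈[ m ] 𝟘
mono≈[]𝟘 k X m≤k = below λ i l → coeff-mono-< X (<-≤-trans l m≤k)

-- Each pass through the recurrence multiplies the unknown by a positive power of q, so agreement
-- modulo q^m improves to agreement modulo q^(m+1).
recurrence-unique : ∀ k .{{_ : NonZero k}} {c X Y} →
                    X ≈ c ⊕ mono k ⊗ X → Y ≈ c ⊕ mono k ⊗ Y → X ≈ Y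
recurrence-unique (suc k) {c} {X} {Y} p r = pointwise λ n → at< (agree (suc n)) n ≤-refl
  where
  agree : ∀ m → X ≈[ m ] Y
  agree zero    = below λ _ ()
  agree (suc m) = Trunc.trans (≈⇒≈[] p) (Trunc.trans
    (⊕-cong[] Trunc.refl
      (≈[]-weaken (s≤s (m≤n+m m k)) (mono-≈[] (suc k) (agree m))))
    (≈⇒≈[] (≈-sym r)))

-- Geometric series

-- countdown k r n = 1 exactly when n ≡ r modulo k + 1 (for r ≤ k).
countdown : ℕ → ℕ → ℕ → ℕ
countdown k zero    zero    = 1
countdown k zero    (suc n) = countdown k k n
countdown k (suc r) zero    = 0
countdown k (suc r) (suc n) = countdown k r n

-- geo k = 1 / (1 − q^k), with the junk value geo 0 = 0.
geo : ℕ → Series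
geo zero    = 𝟘
geo (suc k) = series (countdown k 0)

geo-unfold : ∀ k .{{_ : NonZero k}} → geo k ≈ 𝟙 ⊕ mono k ⊗ geo k
geo-unfold (suc k) = pointwise λ
  { zero    → refl
  ; (suc n) → coeff-countdown k n }
  where
  -- The counter r is the number of steps until the next 1, so `countdown k r` is q^r times the
  -- geometric series; r = k is the case required.
  coeff-countdown : ∀ r n → countdown k r n ≡ coeff (mono r ⊗ geo (suc k)) n
  coeff-countdown zero    n       = sym (at (𝟙-identityˡ (geo (suc k))) n)
  coeff-countdown (suc r) zero    = refl
  coeff-countdown (suc r) (suc n) = coeff-countdown r n

geo-unfold-⊗ : ∀ k .{{_ : NonZero k}} c → geo k ⊗ c ≈ c ⊕ mono k ⊗ (geo k ⊗ c)
geo-unfold-⊗ k c = ≈-trans (⊗-congʳ (geo-unfold k))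
  (solve 3 (λ x g c → (con 1 :+ x :* g) :* c := c :+ x :* (g :* c)) ≈-refl (mono k) (geo k) c)

geo-unique : ∀ k .{{_ : NonZero k}} {c X} → X ≈ c ⊕ mono k ⊗ X → X ≈ geo k ⊗ c
geo-unique k {c} p = recurrence-unique k p (geo-unfold-⊗ k c)

-- Unfolding 1/(1 - x) twice gives a recurrence of step x², whose solution is (1 + x)/(1 - x²).
geo-half : ∀ a .{{_ : NonZero a}} .{{_ : NonZero (2 * a)}} →
           geo a ≈ geo (2 * a) ⊗ (𝟙 ⊕ mono a)
geo-half a = geo-unique (2 * a) (begin
  geo a
    ≈⟨ geo-unfold a ⟩
  𝟙 ⊕ mono a ⊗ geo a
    ≈⟨ ⊕-congˡ (⊗-congˡ (geo-unfold a)) ⟩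
  𝟙 ⊕ mono a ⊗ (𝟙 ⊕ mono a ⊗ geo a)
    ≈⟨ solve 2 (λ x g → con 1 :+ x :* (con 1 :+ x :* g) := (con 1 :+ x) :+ (x :* x) :* g)
         ≈-refl (mono a) (geo a) ⟩
  (𝟙 ⊕ mono a) ⊕ (mono a ⊗ mono a) ⊗ geo a
    ≈⟨ ⊕-congˡ (⊗-congʳ (mono-+ a a)) ⟨
  (𝟙 ⊕ mono a) ⊕ mono (a + a) ⊗ geo a
    ≡⟨ cong (λ e → (𝟙 ⊕ mono a) ⊕ mono (a + e) ⊗ geo a) (+-identityʳ a) ⟨
  (𝟙 ⊕ mono a) ⊕ mono (2 * a) ⊗ geo a ∎)
  where open ≈-Reasoning

-- The subtraction-free form of 1 - xy = (1 - x) + x(1 - y), the identity behind Pascal's rule for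
-- Gaussian binomials.
geo-⊗-geo : ∀ a b .{{_ : NonZero a}} .{{_ : NonZero b}} .{{_ : NonZero (a + b)}} →
            geo a ⊗ geo b ≈ geo (a + b) ⊗ (geo b ⊕ mono a ⊗ geo a)
geo-⊗-geo a b = geo-unique (a + b) (begin
  geo a ⊗ geo b
    ≈⟨ geo-unfold-⊗ a (geo b) ⟩
  geo b ⊕ mono a ⊗ (geo a ⊗ geo b)
    ≈⟨ ⊕-congˡ (⊗-congˡ (≈-trans (⊗-comm (geo a) (geo b)) (geo-unfold-⊗ b (geo a)))) ⟩
  geo b ⊕ mono a ⊗ (geo a ⊕ mono b ⊗ (geo b ⊗ geo a))
    ≈⟨ solve 4 (λ x y g h → h :+ x :* (g :+ y :* (h :* g)) := (h :+ x :* g) :+ (x :* y) :* (g :* h))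
         ≈-refl (mono a) (mono b) (geo a) (geo b) ⟩
  (geo b ⊕ mono a ⊗ geo a) ⊕ (mono a ⊗ mono b) ⊗ (geo a ⊗ geo b)
    ≈⟨ ⊕-congˡ (⊗-congʳ (mono-+ a b)) ⟨
  (geo b ⊕ mono a ⊗ geo a) ⊕ mono (a + b) ⊗ (geo a ⊗ geo b) ∎)
  where open ≈-Reasoning

-- Multiplication by 1 - q^k becomes additive cancellation: after one unfolding the two tails agree
-- by hypothesis.
geo-cancel : ∀ k .{{_ : NonZero k}} {X Y m} → geo k ⊗ X ≈[ m ] geo k ⊗ Y → X ≈[ m ] Y
geo-cancel k {X} {Y} p = below λ i l → +-cancelʳ-≡ (coeff (mono k ⊗ (geo k ⊗ X)) i) _ _ (begin
  coeff X i + coeff (mono k ⊗ (geo k ⊗ X)) i  ≡⟨ at (geo-unfold-⊗ k X) i ⟨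
  coeff (geo k ⊗ X) i                         ≡⟨ at< p i l ⟩
  coeff (geo k ⊗ Y) i                         ≡⟨ at (geo-unfold-⊗ k Y) i ⟩
  coeff Y i + coeff (mono k ⊗ (geo k ⊗ Y)) i
    ≡⟨ cong (coeff Y i +_) (at< (⊗-cong[] (Trunc.refl {x = mono k}) p) i l) ⟨
  coeff Y i + coeff (mono k ⊗ (geo k ⊗ X)) i  ∎)
  where open ≡-Reasoning

-- Products and sums of series

prod : (ℕ → Series) → ℕ → Series
prod f zero    = 𝟙
prod f (suc n) = f n ⊗ prod f n

prod-cong : ∀ {f g} → (∀ k → f k ≈ g k) → ∀ n → prod f n ≈ prod g n
prod-cong p zero    = ≈-refl
prod-cong p (suc n) = ⊗-cong (p n) (prod-cong p n)

prod-⊗ : ∀ f g n → prod (λ k → f k ⊗ g k) n ≈ prod f n ⊗ prod g n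
prod-⊗ f g zero    = ≈-sym (𝟙-identityˡ 𝟙)
prod-⊗ f g (suc n) = ≈-trans (⊗-congˡ (prod-⊗ f g n))
  (solve 4 (λ a b c d → (a :* b) :* (c :* d) := (a :* c) :* (b :* d)) ≈-refl
     (f n) (g n) (prod f n) (prod g n))

-- Passing both indices of r + s = n keeps truncated subtraction out of the summands.
antidiagonal : ℕ → (ℕ → ℕ → Series) → Series
antidiagonal zero    f = f 0 0
antidiagonal (suc n) f = f 0 (suc n) ⊕ antidiagonal n (λ r s → f (suc r) s)

antidiagonal-cong[] : ∀ {m} n {f g} → (∀ r s → r + s ≡ n → f r s ≈[ m ] g r s) →
                      antidiagonal n f ≈[ m ] antidiagonal n g
antidiagonal-cong[] zero    p = p 0 0 refl
antidiagonal-cong[] (suc n) p = ⊕-cong[] (p 0 (suc n) refl)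
  (antidiagonal-cong[] n (λ r s eq → p (suc r) s (cong suc eq)))

antidiagonal-cong : ∀ n {f g} → (∀ r s → r + s ≡ n → f r s ≈ g r s) →
                    antidiagonal n f ≈ antidiagonal n g
antidiagonal-cong zero    p = p 0 0 refl
antidiagonal-cong (suc n) p = ⊕-cong (p 0 (suc n) refl)
  (antidiagonal-cong n (λ r s eq → p (suc r) s (cong suc eq)))

antidiagonal-last : ∀ n f → antidiagonal (suc n) f ≈
                            antidiagonal n (λ r s → f r (suc s)) ⊕ f (suc n) 0
antidiagonal-last zero    f = ≈-refl
antidiagonal-last (suc n) f = ≈-trans
  (⊕-congˡ (antidiagonal-last n (λ r s → f (suc r) s))) (≈-sym (⊕-assoc _ _ _))

antidiagonal-⊕ : ∀ n f g → antidiagonal n (λ r s → f r s ⊕ g r s) ≈ antidiagonal n f ⊕ antidiagonal n g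
antidiagonal-⊕ zero    f g = ≈-refl
antidiagonal-⊕ (suc n) f g = ≈-trans (⊕-congˡ (antidiagonal-⊕ n _ _))
  (solve 4 (λ a b c d → (a :+ b) :+ (c :+ d) := (a :+ c) :+ (b :+ d)) ≈-refl _ _ _ _)

antidiagonal-⊗ʳ : ∀ n f c → antidiagonal n (λ r s → f r s ⊗ c) ≈ antidiagonal n f ⊗ c
antidiagonal-⊗ʳ zero    f c = ≈-refl
antidiagonal-⊗ʳ (suc n) f c = ≈-trans (⊕-congˡ (antidiagonal-⊗ʳ n _ c)) (≈-sym (⊗-distribʳ-⊕ c _ _))

-- Gaussian sums

-- gaussSum n x = Σ_m x_m [n choose m] with Gaussian binomials in q², through the
-- rule [n+1, m+1] = [n, m] + q^(2(m+1)) [n, m+1].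
gaussSum : ℕ → (ℕ → Series) → Series
gaussSum zero    x = x 0
gaussSum (suc n) x = gaussSum n (λ m → x (suc m) ⊕ mono (2 * m) ⊗ x m)

gaussSum-cong : ∀ n {x y} → (∀ m → x m ≈ y m) → gaussSum n x ≈ gaussSum n y
gaussSum-cong zero    p = p 0
gaussSum-cong (suc n) p = gaussSum-cong n (λ m → ⊕-cong (p (suc m)) (⊗-congˡ (p m)))

gaussSum-⊗ : ∀ n c x → gaussSum n (λ m → c ⊗ x m) ≈ c ⊗ gaussSum n x
gaussSum-⊗ zero    c x = ≈-refl
gaussSum-⊗ (suc n) c x = ≈-trans
  (gaussSum-cong n (λ m → solve 4 (λ c u v w → c :* u :+ v :* (c :* w) := c :* (u :+ v :* w)) ≈-refl
     c (x (suc m)) (mono (2 * m)) (x m)))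
  (gaussSum-⊗ n c _)

oddFactor : ℕ → Series
oddFactor k = 𝟙 ⊕ mono (suc (2 * k))

square : ℕ → Series
square m = mono (m * m)

shiftedSquare : ℕ → ℕ → Series
shiftedSquare b m = square ∣ m - b ∣

factor-out : ∀ X e → X ⊕ mono e ⊗ X ≈ (𝟙 ⊕ mono e) ⊗ X
factor-out X e = solve 2 (λ x u → x :+ u :* x := (con 1 :+ u) :* x) ≈-refl X (mono e)

-- A Pascal step replaces x m by x (m + 1) + q^(2m) x m. As (m - b - 1)² + 2m = (m - b)² + 2b + 1,
-- it moves the centre from b + 1 to b and splits off a factor independent of m.
gaussSum-shiftedSquare : ∀ n b →
  gaussSum (suc n) (shiftedSquare (suc b)) ≈ oddFactor b ⊗ gaussSum n (shiftedSquare b)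
gaussSum-shiftedSquare n b = ≈-trans (gaussSum-cong n step) (gaussSum-⊗ n (oddFactor b) (shiftedSquare b))
  where
  exponent : ∀ m b → 2 * m + ∣ m - suc b ∣ * ∣ m - suc b ∣ ≡ suc (2 * b) + ∣ m - b ∣ * ∣ m - b ∣
  exponent zero    b       = lemma b
    where
    lemma : ∀ b → suc b * suc b ≡ suc (2 * b) + b * b
    lemma = solve-∀
  exponent (suc m) zero    rewrite ∣-∣-identityʳ m = lemma m
    where
    lemma : ∀ m → 2 * suc m + m * m ≡ suc (suc m * suc m)
    lemma = solve-∀
  exponent (suc m) (suc b) = begin
    2 * suc m + d     ≡⟨ cong (_+ d) (*-suc 2 m) ⟩
    2 + (2 * m + d)   ≡⟨ cong (2 +_) (exponent m b) ⟩
    2 + (suc (2 * b) + e) ≡⟨ cong (λ z → suc z + e) (*-suc 2 b) ⟨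
    suc (2 * suc b) + e ∎
    where
    open ≡-Reasoning
    d = ∣ m - suc b ∣ * ∣ m - suc b ∣
    e = ∣ m - b ∣ * ∣ m - b ∣

  step : ∀ m → shiftedSquare b m ⊕ mono (2 * m) ⊗ shiftedSquare (suc b) m ≈ oddFactor b ⊗ shiftedSquare b m
  step m = begin
    shiftedSquare b m ⊕ mono (2 * m) ⊗ shiftedSquare (suc b) m
      ≈⟨ ⊕-congˡ (mono-+ (2 * m) _) ⟨
    shiftedSquare b m ⊕ mono (2 * m + ∣ m - suc b ∣ * ∣ m - suc b ∣)
      ≡⟨ cong (λ e → shiftedSquare b m ⊕ mono e) (exponent m b) ⟩
    shiftedSquare b m ⊕ mono (suc (2 * b) + ∣ m - b ∣ * ∣ m - b ∣)
      ≈⟨ ⊕-congˡ (mono-+ (suc (2 * b)) _) ⟩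
    shiftedSquare b m ⊕ mono (suc (2 * b)) ⊗ shiftedSquare b m
      ≈⟨ factor-out (shiftedSquare b m) (suc (2 * b)) ⟩
    oddFactor b ⊗ shiftedSquare b m ∎
    where open ≈-Reasoning

-- A case of the q-binomial theorem. The exponent is generalised to m² + 2tm, a form that a Pascal
-- step reproduces with t + 1 while splitting off 1 + q^(2t+1).
gaussSum-square : ∀ n → gaussSum n square ≈ prod oddFactor n
gaussSum-square n = begin
  gaussSum n square
    ≈⟨ gaussSum-cong n (λ m → ≈-reflexive (cong mono (sym (+-identityʳ (m * m))))) ⟩
  gaussSum n (tilted 0)             ≈⟨ 𝟙-identityˡ _ ⟨
  𝟙 ⊗ gaussSum n (tilted 0)         ≈⟨ telescope n 0 ⟩
  prod oddFactor (n + 0)            ≡⟨ cong (prod oddFactor) (+-identityʳ n) ⟩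
  prod oddFactor n ∎
  where
  open ≈-Reasoning
  tilted : ℕ → ℕ → Series
  tilted t m = mono (m * m + 2 * t * m)

  step : ∀ t m → tilted t (suc m) ⊕ mono (2 * m) ⊗ tilted t m ≈ oddFactor t ⊗ tilted (suc t) m
  step t m = begin
    tilted t (suc m) ⊕ mono (2 * m) ⊗ tilted t m
      ≈⟨ ⊕-cong (≈-reflexive (cong mono (exponent₁ t m))) (≈-sym (mono-+ (2 * m) _)) ⟩
    mono (suc (2 * t) + (m * m + 2 * suc t * m)) ⊕ mono (2 * m + (m * m + 2 * t * m))
      ≈⟨ ⊕-cong (mono-+ (suc (2 * t)) _) (≈-reflexive (cong mono (exponent₂ t m))) ⟩
    mono (suc (2 * t)) ⊗ tilted (suc t) m ⊕ tilted (suc t) m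
      ≈⟨ ⊕-comm _ _ ⟩
    tilted (suc t) m ⊕ mono (suc (2 * t)) ⊗ tilted (suc t) m
      ≈⟨ factor-out (tilted (suc t) m) (suc (2 * t)) ⟩
    oddFactor t ⊗ tilted (suc t) m ∎
    where
    exponent₁ : ∀ t m → suc m * suc m + 2 * t * suc m ≡ suc (2 * t) + (m * m + 2 * suc t * m)
    exponent₁ = solve-∀
    exponent₂ : ∀ t m → 2 * m + (m * m + 2 * t * m) ≡ m * m + 2 * suc t * m
    exponent₂ = solve-∀

  telescope : ∀ n t → prod oddFactor t ⊗ gaussSum n (tilted t) ≈ prod oddFactor (n + t)
  telescope zero    t = ≈-trans (⊗-congˡ (≈-reflexive (cong mono (*-zeroʳ (2 * t))))) (⊗-identityʳ _)
  telescope (suc n) t = begin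
    prod oddFactor t ⊗ gaussSum (suc n) (tilted t)
      ≈⟨ ⊗-congˡ (gaussSum-cong n (step t)) ⟩
    prod oddFactor t ⊗ gaussSum n (λ m → oddFactor t ⊗ tilted (suc t) m)
      ≈⟨ ⊗-congˡ (gaussSum-⊗ n (oddFactor t) _) ⟩
    prod oddFactor t ⊗ (oddFactor t ⊗ gaussSum n (tilted (suc t)))
      ≈⟨ solve 3 (λ p f g → p :* (f :* g) := (f :* p) :* g) ≈-refl
           (prod oddFactor t) (oddFactor t) (gaussSum n (tilted (suc t))) ⟩
    prod oddFactor (suc t) ⊗ gaussSum n (tilted (suc t))
      ≈⟨ telescope n (suc t) ⟩
    prod oddFactor (n + suc t)
      ≡⟨ cong (prod oddFactor) (+-suc n t) ⟩
    prod oddFactor (suc n + t) ∎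

-- The finite Jacobi triple product at z = 1.
gaussSum-centered : ∀ b n →
  gaussSum (b + n) (shiftedSquare b) ≈ prod oddFactor b ⊗ prod oddFactor n
gaussSum-centered zero    n = ≈-trans
  (gaussSum-cong n (λ m → ≈-reflexive (cong square (∣-∣-identityʳ m))))
  (≈-trans (gaussSum-square n) (≈-sym (𝟙-identityˡ _)))
gaussSum-centered (suc b) n = ≈-trans (gaussSum-shiftedSquare (b + n) b)
  (≈-trans (⊗-congˡ (gaussSum-centered b n)) (≈-sym (⊗-assoc _ _ _)))

-- invPoch m = 1 / (q²;q²)_m
invPoch : ℕ → Series
invPoch = prod (λ k → geo (2 * suc k))

-- Clears the denominators of the Gaussian binomials: [r+s, r] = (q²)_{r+s} / ((q²)_r (q²)_s).
invPoch-gaussSum : ∀ n x →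
  invPoch n ⊗ gaussSum n x ≈ antidiagonal n (λ r s → x r ⊗ (invPoch r ⊗ invPoch s))
invPoch-gaussSum zero    x = solve 1 (λ x → con 1 :* x := x :* (con 1 :* con 1)) ≈-refl (x 0)
invPoch-gaussSum (suc n) x = begin
  (g ⊗ invPoch n) ⊗ gaussSum n y
    ≈⟨ ⊗-assoc _ _ _ ⟩
  g ⊗ (invPoch n ⊗ gaussSum n y)
    ≈⟨ ⊗-comm _ _ ⟩
  (invPoch n ⊗ gaussSum n y) ⊗ g
    ≈⟨ ⊗-congʳ (invPoch-gaussSum n y) ⟩
  antidiagonal n (λ r s → y r ⊗ W r s) ⊗ g
    ≈⟨ antidiagonal-⊗ʳ n _ g ⟨
  antidiagonal n (λ r s → y r ⊗ W r s ⊗ g)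
    ≈⟨ antidiagonal-cong n (λ r s _ →
         solve 5 (λ a u b w g → (a :+ u :* b) :* w :* g := a :* (g :* w) :+ b :* (g :* (u :* w))) ≈-refl
           (x (suc r)) (mono (2 * r)) (x r) (W r s) g) ⟩
  antidiagonal n (λ r s → left (suc r) s ⊕ right r (suc s))
    ≈⟨ antidiagonal-⊕ n _ _ ⟩
  antidiagonal n (λ r s → left (suc r) s) ⊕ antidiagonal n (λ r s → right r (suc s))
    ≈⟨ ⊕-cong (≈-sym pad-left) (≈-sym pad-right) ⟩
  antidiagonal (suc n) left ⊕ antidiagonal (suc n) right
    ≈⟨ antidiagonal-⊕ (suc n) left right ⟨
  antidiagonal (suc n) (λ r s → left r s ⊕ right r s)
    ≈⟨ antidiagonal-cong (suc n) pascal ⟩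
  antidiagonal (suc n) (λ r s → x r ⊗ W r s) ∎
  where
  open ≈-Reasoning
  g = geo (2 * suc n)
  y : ℕ → Series
  y m = x (suc m) ⊕ mono (2 * m) ⊗ x m
  W : ℕ → ℕ → Series
  W r s = invPoch r ⊗ invPoch s
  -- Each term of Pascal's rule runs over r + s = n with one index raised. Padding with 𝟘 at the
  -- missing end puts both on r + s = n + 1, where they add termwise.
  W⁻ˡ W⁻ʳ left right : ℕ → ℕ → Series
  W⁻ˡ zero    s = 𝟘
  W⁻ˡ (suc r) s = W r s
  W⁻ʳ r zero    = 𝟘
  W⁻ʳ r (suc s) = mono (2 * r) ⊗ W r s
  left  r s = x r ⊗ (g ⊗ W⁻ˡ r s)
  right r s = x r ⊗ (g ⊗ W⁻ʳ r s)

  vanish : ∀ c → c ⊗ (g ⊗ 𝟘) ≈ 𝟘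
  vanish c = ≈-trans (⊗-congˡ (⊗-zeroʳ g)) (⊗-zeroʳ c)

  pad-left : antidiagonal (suc n) left ≈ antidiagonal n (λ r s → left (suc r) s)
  pad-left = ≈-trans (⊕-congʳ (vanish (x 0))) (⊕-identityˡ _)

  pad-right : antidiagonal (suc n) right ≈ antidiagonal n (λ r s → right r (suc s))
  pad-right = ≈-trans (antidiagonal-last n right)
    (≈-trans (⊕-congˡ (vanish (x (suc n)))) (⊕-identityʳ _))

  -- In the interior this is `geo-⊗-geo` at exponents 2(r + 1) and 2(s + 1) in terms of the
  -- predecessors, which add up to 2(n + 1); on the boundary one summand is padding.
  W-pascal : ∀ r s → r + s ≡ suc n → g ⊗ (W⁻ˡ r s ⊕ W⁻ʳ r s) ≈ W r s
  W-pascal zero    (suc s) refl =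
    solve 2 (λ g p → g :* (con 0 :+ con 1 :* (con 1 :* p)) := con 1 :* (g :* p)) ≈-refl g (invPoch s)
  W-pascal (suc r) zero    eq   with refl ← trans (sym (+-identityʳ r)) (suc-injective eq) =
    solve 2 (λ g p → g :* (p :* con 1 :+ con 0) := (g :* p) :* con 1) ≈-refl g (invPoch r)
  W-pascal (suc r) (suc s) eq   = begin
    g ⊗ (invPoch r ⊗ (b ⊗ invPoch s) ⊕ u ⊗ ((a ⊗ invPoch r) ⊗ invPoch s))
      ≈⟨ solve 6 (λ g p q a b u → g :* (p :* (b :* q) :+ u :* ((a :* p) :* q))
                                    := (g :* (b :+ u :* a)) :* (p :* q)) ≈-refl
           g (invPoch r) (invPoch s) a b u ⟩
    (g ⊗ (b ⊕ u ⊗ a)) ⊗ (invPoch r ⊗ invPoch s)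
      ≡⟨ cong (λ e → (geo e ⊗ (b ⊕ u ⊗ a)) ⊗ (invPoch r ⊗ invPoch s)) exponent ⟩
    (geo (2 * suc r + 2 * suc s) ⊗ (b ⊕ u ⊗ a)) ⊗ (invPoch r ⊗ invPoch s)
      ≈⟨ ⊗-congʳ (geo-⊗-geo (2 * suc r) (2 * suc s)) ⟨
    (a ⊗ b) ⊗ (invPoch r ⊗ invPoch s)
      ≈⟨ solve 4 (λ a b p q → (a :* b) :* (p :* q) := (a :* p) :* (b :* q)) ≈-refl
           a b (invPoch r) (invPoch s) ⟩
    W (suc r) (suc s) ∎
    where
    a = geo (2 * suc r)
    b = geo (2 * suc s)
    u = mono (2 * suc r)
    exponent : 2 * suc n ≡ 2 * suc r + 2 * suc s
    exponent = trans (cong (2 *_) (sym eq)) (*-distribˡ-+ 2 (suc r) (suc s))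

  pascal : ∀ r s → r + s ≡ suc n → left r s ⊕ right r s ≈ x r ⊗ W r s
  pascal r s eq = ≈-trans
    (solve 4 (λ x g u v → x :* (g :* u) :+ x :* (g :* v) := x :* (g :* (u :+ v))) ≈-refl
       (x r) g (W⁻ˡ r s) (W⁻ʳ r s))
    (⊗-congˡ (W-pascal r s eq))

-- Overpartition products

overFactor : ℕ → Series
overFactor k = (𝟙 ⊕ mono k) ⊗ geo k

overFactor-expand : ∀ u g X → ((𝟙 ⊕ u) ⊗ g) ⊗ X ≈ g ⊗ X ⊕ u ⊗ (g ⊗ X)
overFactor-expand = solve 3 (λ u g x → ((con 1 :+ u) :* g) :* x := g :* x :+ u :* (g :* x)) ≈-refl

-- The generating functions of overpartitions into odd parts below 2N, and into even
-- parts up to 2N.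
oddOver evenOver : ℕ → Series
oddOver  = prod (λ k → overFactor (suc (2 * k)))
evenOver = prod (λ k → overFactor (2 * suc k))

-- invPoch₄ m = 1 / (q⁴;q⁴)_m and invPochOdd m = 1 / (q²;q⁴)_m
invPoch₄ invPochOdd : ℕ → Series
invPoch₄   = prod (λ k → geo (2 * (2 * suc k)))
invPochOdd = prod (λ k → geo (2 * suc (2 * k)))

invPoch-double : ∀ n → invPoch (n + n) ≈ invPochOdd n ⊗ invPoch₄ n
invPoch-double zero    = ≈-sym (𝟙-identityˡ 𝟙)
invPoch-double (suc n) rewrite +-suc n n = begin
  geo (2 * suc (suc (n + n))) ⊗ (geo (2 * suc (n + n)) ⊗ invPoch (n + n))
    ≡⟨ cong₂ (λ a b → geo (2 * a) ⊗ (geo (2 * b) ⊗ invPoch (n + n))) (exponent₁ n) (exponent₂ n) ⟩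
  a ⊗ (b ⊗ invPoch (n + n))
    ≈⟨ ⊗-congˡ (⊗-congˡ (invPoch-double n)) ⟩
  a ⊗ (b ⊗ (invPochOdd n ⊗ invPoch₄ n))
    ≈⟨ solve 4 (λ a b p q → a :* (b :* (p :* q)) := (b :* p) :* (a :* q)) ≈-refl
         a b (invPochOdd n) (invPoch₄ n) ⟩
  invPochOdd (suc n) ⊗ invPoch₄ (suc n) ∎
  where
  open ≈-Reasoning
  a = geo (2 * (2 * suc n))
  b = geo (2 * suc (2 * n))
  exponent₁ : ∀ n → suc (suc (n + n)) ≡ 2 * suc n
  exponent₁ = solve-∀
  exponent₂ : ∀ n → suc (n + n) ≡ suc (2 * n)
  exponent₂ = solve-∀

-- Writing 1/(1 - x) as (1 + x)/(1 - x²) supplies the second copy of the odd product that the triple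
-- product calls for.
oddOver-split : ∀ n → oddOver n ≈ (prod oddFactor n ⊗ prod oddFactor n) ⊗ invPochOdd n
oddOver-split n = begin
  oddOver n
    ≈⟨ prod-cong (λ k → ⊗-congˡ (geo-half (suc (2 * k)))) n ⟩
  prod (λ k → oddFactor k ⊗ (geo (2 * suc (2 * k)) ⊗ oddFactor k)) n
    ≈⟨ prod-⊗ oddFactor _ n ⟩
  prod oddFactor n ⊗ prod (λ k → geo (2 * suc (2 * k)) ⊗ oddFactor k) n
    ≈⟨ ⊗-congˡ (prod-⊗ _ oddFactor n) ⟩
  prod oddFactor n ⊗ (invPochOdd n ⊗ prod oddFactor n)
    ≈⟨ solve 2 (λ a r → a :* (r :* a) := (a :* a) :* r) ≈-refl (prod oddFactor n) (invPochOdd n) ⟩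
  (prod oddFactor n ⊗ prod oddFactor n) ⊗ invPochOdd n ∎
  where open ≈-Reasoning

-- Here `geo-half` is read backwards: 1/(q⁴;q⁴)_n absorbs the numerators of `evenOver`.
evenOver-split : ∀ n → invPoch₄ n ⊗ evenOver n ≈ invPoch n ⊗ invPoch n
evenOver-split n = begin
  invPoch₄ n ⊗ evenOver n
    ≈⟨ prod-⊗ _ _ n ⟨
  prod (λ k → geo (2 * (2 * suc k)) ⊗ overFactor (2 * suc k)) n
    ≈⟨ prod-cong (λ k → ≈-trans (≈-sym (⊗-assoc _ _ _)) (⊗-congʳ (≈-sym (geo-half (2 * suc k))))) n ⟩
  prod (λ k → geo (2 * suc k) ⊗ geo (2 * suc k)) n
    ≈⟨ prod-⊗ _ _ n ⟩
  invPoch n ⊗ invPoch n ∎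
  where open ≈-Reasoning

geo-trunc : ∀ k .{{_ : NonZero k}} c → geo k ⊗ c ≈[ k ] c
geo-trunc k c = Trunc.trans (≈⇒≈[] (geo-unfold-⊗ k c)) (Trunc.trans
  (⊕-cong[] Trunc.refl (mono≈[]𝟘 k (geo k ⊗ c) ≤-refl)) (≈⇒≈[] (⊕-identityʳ c)))

-- Every additional factor is 1/(1 - q^(2k)) with k > t, hence 1 modulo q^(2(t+1)).
invPoch-trunc : ∀ t {r} → t ≤′ r → invPoch r ≈[ 2 * suc t ] invPoch t
invPoch-trunc t ≤′-refl             = Trunc.refl
invPoch-trunc t (≤′-step {r} t≤′r) = Trunc.trans
  (≈[]-weaken (*-monoʳ-≤ 2 (s≤s (≤′⇒≤ t≤′r))) (geo-trunc (2 * suc r) (invPoch r)))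
  (invPoch-trunc t t≤′r)

invPoch₄-cancel : ∀ n {X Y m} → invPoch₄ n ⊗ X ≈[ m ] invPoch₄ n ⊗ Y → X ≈[ m ] Y
invPoch₄-cancel zero    {X} {Y} p =
  Trunc.trans (≈⇒≈[] (≈-sym (𝟙-identityˡ X))) (Trunc.trans p (≈⇒≈[] (𝟙-identityˡ Y)))
invPoch₄-cancel (suc n) {X} {Y} p = invPoch₄-cancel n (geo-cancel (2 * (2 * suc n))
  (Trunc.trans (≈⇒≈[] (≈-sym (⊗-assoc _ _ X))) (Trunc.trans p (≈⇒≈[] (⊗-assoc _ _ Y)))))

-- The theta series Σ q^(j²) cut to |j| ≤ n, with j = r - n.
theta : ℕ → Series
theta n = antidiagonal (n + n) (λ r _ → shiftedSquare n r)

complement-near : ∀ n r s → r + s ≡ n + n → n ≤ ∣ r - n ∣ + s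
complement-near n r s eq = +-cancelˡ-≤ n n (∣ r - n ∣ + s) (begin
  n + n                  ≡⟨ eq ⟨
  r + s                  ≤⟨ +-monoˡ-≤ s (m≤n+∣m-n∣ r n) ⟩
  n + ∣ r - n ∣ + s      ≡⟨ +-assoc n ∣ r - n ∣ s ⟩
  n + (∣ r - n ∣ + s)    ∎)
  where open ≤-Reasoning

oddOver≈theta : ∀ n → oddOver n ≈[ suc (2 * n) ] theta n ⊗ evenOver n
oddOver≈theta n = invPoch₄-cancel n (begin
  invPoch₄ n ⊗ oddOver n
    ≈⟨ ≈⇒≈[] clear ⟩
  antidiagonal (n + n) (λ r s → shiftedSquare n r ⊗ (invPoch r ⊗ invPoch s))
    ≈⟨ antidiagonal-cong[] (n + n) approx ⟩
  antidiagonal (n + n) (λ r s → shiftedSquare n r ⊗ (invPoch n ⊗ invPoch n))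
    ≈⟨ ≈⇒≈[] (antidiagonal-⊗ʳ (n + n) _ _) ⟩
  theta n ⊗ (invPoch n ⊗ invPoch n)
    ≈⟨ ≈⇒≈[] (⊗-congˡ (≈-sym (evenOver-split n))) ⟩
  theta n ⊗ (invPoch₄ n ⊗ evenOver n)
    ≈⟨ ≈⇒≈[] (solve 3 (λ t s e → t :* (s :* e) := s :* (t :* e)) ≈-refl
         (theta n) (invPoch₄ n) (evenOver n)) ⟩
  invPoch₄ n ⊗ (theta n ⊗ evenOver n) ∎)
  where
  open SetoidReasoning (truncSetoid (suc (2 * n)))
  -- 1/(q⁴;q⁴)_n completes the 1/(q²;q⁴)_n inside `oddOver` to 1/(q²;q²)_(2n), exactly what clears
  -- the denominators of a Gaussian sum of length 2n.
  clear : invPoch₄ n ⊗ oddOver n ≈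
          antidiagonal (n + n) (λ r s → shiftedSquare n r ⊗ (invPoch r ⊗ invPoch s))
  clear = ≈-trans (⊗-congˡ (oddOver-split n)) (≈-trans
    (solve 3 (λ s a r → s :* (a :* r) := (r :* s) :* a) ≈-refl
       (invPoch₄ n) (prod oddFactor n ⊗ prod oddFactor n) (invPochOdd n))
    (≈-trans (⊗-cong (≈-sym (invPoch-double n)) (≈-sym (gaussSum-centered n n)))
      (invPoch-gaussSum (n + n) (shiftedSquare n))))

  -- With t = n − d the error terms have order d² + 2(n − d + 1) = 2n + 1 + (d − 1)².
  order : ∀ d → suc (2 * n) ≤ d * d + 2 * suc (n ∸ d)
  order d = ≤-trans (s≤s (*-monoʳ-≤ 2 (m≤n+m∸n n d))) (bound d (n ∸ d))
    where
    bound : ∀ d t → suc (2 * (d + t)) ≤ d * d + 2 * suc t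
    bound zero    t = ≤-trans (n≤1+n _) (≤-reflexive (lemma t))
      where
      lemma : ∀ t → suc (suc (2 * t)) ≡ 2 * suc t
      lemma = solve-∀
    bound (suc d) t = ≤-trans (m≤m+n _ (d * d)) (≤-reflexive (lemma d t))
      where
      lemma : ∀ d t → suc (2 * (suc d + t)) + d * d ≡ suc d * suc d + 2 * suc t
      lemma = solve-∀

  -- As m may lie on either side of n, both are compared with their common lower bound n - d.
  near : ∀ d m → n ≤ d + m → invPoch m ≈[ 2 * suc (n ∸ d) ] invPoch n
  near d m le = Trunc.trans
    (invPoch-trunc (n ∸ d) (≤⇒≤′ (m≤n+o⇒m∸n≤o n d le)))
    (Trunc.sym (invPoch-trunc (n ∸ d) (≤⇒≤′ (m∸n≤m n d))))

  approx : ∀ r s → r + s ≡ n + n →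
           shiftedSquare n r ⊗ (invPoch r ⊗ invPoch s) ≈[ suc (2 * n) ]
           shiftedSquare n r ⊗ (invPoch n ⊗ invPoch n)
  approx r s eq = ≈[]-weaken (order d) (mono-≈[] (d * d) (⊗-cong[] (near d r r-near) (near d s s-near)))
    where
    d = ∣ r - n ∣
    r-near : n ≤ d + r
    r-near = subst (n ≤_) (+-comm r d) (m≤n+∣n-m∣ n r)
    s-near : n ≤ d + s
    s-near = complement-near n r s eq

-- Overpartitions with restricted part sizes

sum-applyUpTo-last : ∀ f n → sum (applyUpTo f (suc n)) ≡ sum (applyUpTo f n) + f n
sum-applyUpTo-last f n = begin
  sum (applyUpTo f (suc n))            ≡⟨ cong sum (applyUpTo-∷ʳ f n) ⟨
  sum (applyUpTo f n ++ f n ∷ [])      ≡⟨ sum-++ (applyUpTo f n) _ ⟩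
  sum (applyUpTo f n) + (f n + 0)      ≡⟨ cong (sum (applyUpTo f n) +_) (+-identityʳ (f n)) ⟩
  sum (applyUpTo f n) + f n            ∎
  where open ≡-Reasoning

sum-applyUpTo-cong : ∀ {f g} n → (∀ i → i < n → f i ≡ g i) →
                     sum (applyUpTo f n) ≡ sum (applyUpTo g n)
sum-applyUpTo-cong zero    p = refl
sum-applyUpTo-cong (suc n) p =
  cong₂ _+_ (p 0 (s≤s z≤n)) (sum-applyUpTo-cong n (λ i i<n → p (suc i) (s≤s i<n)))

-- Counting list elements by Boolean predicates

count : {A : Set} → (A → Bool) → List A → ℕ
count p xs = length (filterᵇ p xs)

module _ {A : Set} where

  count-∷ : ∀ (p : A → Bool) x xs → count p (x ∷ xs) ≡ (if p x then 1 else 0) + count p xs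
  count-∷ p x xs with p x
  ... | true  = refl
  ... | false = refl

  count-cong : ∀ {p r : A → Bool} → (∀ x → p x ≡ r x) → ∀ xs → count p xs ≡ count r xs
  count-cong         eq []       = refl
  count-cong {p} {r} eq (x ∷ xs) = begin
    count p (x ∷ xs)                      ≡⟨ count-∷ p x xs ⟩
    (if p x then 1 else 0) + count p xs   ≡⟨ cong₂ (λ b n → (if b then 1 else 0) + n) (eq x) (count-cong eq xs) ⟩
    (if r x then 1 else 0) + count r xs   ≡⟨ count-∷ r x xs ⟨
    count r (x ∷ xs)                      ∎
    where open ≡-Reasoning

  count-filterᵇ : ∀ (p r : A → Bool) xs → count r (filterᵇ p xs) ≡ count (λ x → p x ∧ r x) xs
  count-filterᵇ p r []       = refl
  count-filterᵇ p r (x ∷ xs) with p x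
  ... | false = count-filterᵇ p r xs
  ... | true  with r x
  ...   | true  = cong suc (count-filterᵇ p r xs)
  ...   | false = count-filterᵇ p r xs

  count-∧ˡ : ∀ b (p : A → Bool) xs → count (λ x → b ∧ p x) xs ≡ (if b then count p xs else 0)
  count-∧ˡ true  p xs       = refl
  count-∧ˡ false p []       = refl
  count-∧ˡ false p (x ∷ xs) = count-∧ˡ false p xs

  count-++ : ∀ (p : A → Bool) xs ys → count p (xs ++ ys) ≡ count p xs + count p ys
  count-++ p []       ys = refl
  count-++ p (x ∷ xs) ys with p x
  ... | true  = cong suc (count-++ p xs ys)
  ... | false = count-++ p xs ys

  count-map : ∀ {B : Set} (p : A → Bool) (f : B → A) xs → count p (map f xs) ≡ count (λ x → p (f x)) xs
  count-map p f []       = refl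
  count-map p f (x ∷ xs) with p (f x)
  ... | true  = cong suc (count-map p f xs)
  ... | false = count-map p f xs

  count-concatMap-applyUpTo : ∀ {B : Set} (p : A → Bool) (F : B → List A) f n →
    count p (concatMap F (applyUpTo f n)) ≡ sum (applyUpTo (λ i → count p (F (f i))) n)
  count-concatMap-applyUpTo p F f zero    = refl
  count-concatMap-applyUpTo p F f (suc n) = trans (count-++ p (F (f 0)) _)
    (cong (count p (F (f 0)) +_) (count-concatMap-applyUpTo p F (λ i → f (suc i)) n))

count-candidates : ∀ (p : List Part → Bool) f n → count p (candidates (suc f) (suc n)) ≡
  sum (applyUpTo (λ j → count (λ l → p ((suc j , true)  ∷ l)) (candidates f (n ∸ j))
                      + count (λ l → p ((suc j , false) ∷ l)) (candidates f (n ∸ j))) (suc n))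
count-candidates p f n = trans
  (count-concatMap-applyUpTo p
    (λ k → concatMap (λ b → map ((k , b) ∷_) (candidates f (suc n ∸ k))) (true ∷ false ∷ []))
    suc (suc n))
  (sum-applyUpTo-cong (suc n) (λ j _ → begin
    count p (map ((suc j , true) ∷_) (C j) ++ map ((suc j , false) ∷_) (C j) ++ [])
      ≡⟨ count-++ p (map ((suc j , true) ∷_) (C j)) _ ⟩
    count p (map ((suc j , true) ∷_) (C j)) + count p (map ((suc j , false) ∷_) (C j) ++ [])
      ≡⟨ cong₂ _+_ (count-map p _ (C j)) (trans (count-++ p (map ((suc j , false) ∷_) (C j)) [])
           (trans (+-identityʳ _) (count-map p _ (C j)))) ⟩
    count (λ l → p ((suc j , true) ∷ l)) (C j) + count (λ l → p ((suc j , false) ∷ l)) (C j) ∎))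
  where
  open ≡-Reasoning
  C : ℕ → List (List Part)
  C j = candidates f (n ∸ j)

<ᵇ-true : ∀ {m n} → m < n → (m <ᵇ n) ≡ true
<ᵇ-true {zero}  (s≤s _)   = refl
<ᵇ-true {suc m} (s≤s m<n) = <ᵇ-true m<n

<ᵇ-false : ∀ {m n} → n ≤ m → (m <ᵇ n) ≡ false
<ᵇ-false {m} z≤n             = refl
<ᵇ-false     (s≤s {n} {m} p) = <ᵇ-false p

≡ᵇ-refl : ∀ n → (n ≡ᵇ n) ≡ true
≡ᵇ-refl zero    = refl
≡ᵇ-refl (suc n) = ≡ᵇ-refl n

≡ᵇ-false : ∀ {m n} → m < n → (n ≡ᵇ m) ≡ false
≡ᵇ-false {zero}  (s≤s _)   = refl
≡ᵇ-false {suc m} (s≤s m<n) = ≡ᵇ-false m<n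

module Restricted (allowed : ℕ → Bool) where

  allAllowed : List Part → Bool
  allAllowed []            = true
  allAllowed ((a , _) ∷ l) = allowed a ∧ allAllowed l

  mayFollow : ℕ → ℕ → Bool → Bool
  mayFollow k a f = (a ≤ᵇ k) ∧ (not (k ≡ᵇ a) ∨ not f)

  -- tailOf k l: l is the rest of an overpartition in which it is preceded by a part k.
  tailOf : ℕ → List Part → Bool
  tailOf k []            = true
  tailOf k ((a , f) ∷ l) = mayFollow k a f ∧ ((0 <ᵇ a) ∧ (allowed a ∧ tailOf a l))

  -- The flag `f` is absent on the right: a first part is free to be overlined, the origin of the
  -- doubled terms in `count-overpartitions`.
  overpartition-∷ : ∀ a f l →
    isOverpartition ((a , f) ∷ l) ∧ allAllowed ((a , f) ∷ l) ≡ (0 <ᵇ a) ∧ (allowed a ∧ tailOf a l)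
  overpartition-∷ a f []            =
    solve∧ 2 (λ p r → ((p ⊹ 𝟏) ⊹ 𝟏) ⊹ (r ⊹ 𝟏) ⊜ p ⊹ (r ⊹ 𝟏)) refl (0 <ᵇ a) (allowed a)
  overpartition-∷ a f ((b , g) ∷ l) = trans
    (solve∧ 7 (λ pa P c x W ra R → ((pa ⊹ P) ⊹ (c ⊹ (x ⊹ W))) ⊹ (ra ⊹ R)
                                ⊜ pa ⊹ (ra ⊹ ((c ⊹ x) ⊹ ((P ⊹ W) ⊹ R)))) refl
      (0 <ᵇ a) (allPos ((b , g) ∷ l)) (b ≤ᵇ a) (not (a ≡ᵇ b) ∨ not g)
      (wellOrdered ((b , g) ∷ l)) (allowed a) (allAllowed ((b , g) ∷ l)))
    (cong (λ t → (0 <ᵇ a) ∧ (allowed a ∧ (mayFollow a b g ∧ t))) (overpartition-∷ b g l))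

  -- Counts the overpartitions with allowed parts, all at most k.
  bounded : ℕ → Series
  bounded zero    = 𝟙
  bounded (suc k) = if allowed (suc k) then overFactor (suc k) ⊗ bounded k else bounded k

  -- Counts those with allowed parts whose largest part is k + 1 and not overlined.
  largest : ℕ → Series
  largest k = if allowed (suc k) then mono (suc k) ⊗ (geo (suc k) ⊗ bounded k) else 𝟘

  -- What may follow a part k + 1: a list with parts at most k, or one that begins with an unmarked
  -- k + 1.
  tails : ℕ → Series
  tails k = bounded k ⊕ largest k

  bounded-suc : ∀ k → bounded (suc k) ≈ bounded k ⊕ (largest k ⊕ largest k)
  bounded-suc k with allowed (suc k)
  ... | false = ≈-sym (≈-trans (⊕-congˡ (⊕-identityˡ 𝟘)) (⊕-identityʳ (bounded k)))
  ... | true  = begin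
    ((𝟙 ⊕ u) ⊗ g) ⊗ B                ≈⟨ overFactor-expand u g B ⟩
    g ⊗ B ⊕ u ⊗ (g ⊗ B)              ≈⟨ ⊕-congʳ (geo-unfold-⊗ (suc k) B) ⟩
    (B ⊕ u ⊗ (g ⊗ B)) ⊕ u ⊗ (g ⊗ B)  ≈⟨ ⊕-assoc _ _ _ ⟩
    B ⊕ (u ⊗ (g ⊗ B) ⊕ u ⊗ (g ⊗ B))  ∎
    where
    open ≈-Reasoning
    u = mono (suc k)
    g = geo (suc k)
    B = bounded k

  -- Removing the leading k + 1 leaves precisely a list that may follow k + 1.
  largest-tails : ∀ k → largest k ≈ (if allowed (suc k) then mono (suc k) ⊗ tails k else 𝟘)
  largest-tails k with allowed (suc k)
  ... | false = ≈-refl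
  ... | true  = ⊗-congˡ (geo-unfold-⊗ (suc k) (bounded k))

  largest-small : ∀ k {n} → n ≤ k → coeff (largest k) n ≡ 0
  largest-small k n≤k with allowed (suc k)
  ... | false = refl
  ... | true  = coeff-mono-< (geo (suc k) ⊗ bounded k) (s≤s n≤k)

  bounded-stable : ∀ {k k′} → k ≤′ k′ → ∀ {n} → n ≤ k → coeff (bounded k′) n ≡ coeff (bounded k) n
  bounded-stable ≤′-refl                n≤k = refl
  bounded-stable {k} (≤′-step {m} k≤′m) {n} n≤k = begin
    coeff (bounded (suc m)) n
      ≡⟨ at (bounded-suc m) n ⟩
    coeff (bounded m) n + (coeff (largest m) n + coeff (largest m) n)
      ≡⟨ cong (λ z → coeff (bounded m) n + (z + z)) (largest-small m (≤-trans n≤k (≤′⇒≤ k≤′m))) ⟩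
    coeff (bounded m) n + 0
      ≡⟨ +-identityʳ _ ⟩
    coeff (bounded m) n
      ≡⟨ bounded-stable k≤′m n≤k ⟩
    coeff (bounded k) n ∎
    where open ≡-Reasoning

  -- The sum telescopes along `bounded-suc`; it starts at 0 because 𝟙 has no coefficient at `suc n`.
  doubled : ∀ n M → sum (applyUpTo (λ j → coeff (largest j) (suc n) + coeff (largest j) (suc n)) M)
                    ≡ coeff (bounded M) (suc n)
  doubled n zero    = refl
  doubled n (suc M) = trans (sum-applyUpTo-last _ M)
    (trans (cong (_+ (coeff (largest M) (suc n) + coeff (largest M) (suc n))) (doubled n M))
      (sym (at (bounded-suc M) (suc n))))

  -- The multiplier of `e` is the number of markings with which j + 1 may follow k + 1: two, one or
  -- none as j is below, equal to or above k.
  weighted : ℕ → ℕ → ℕ → ℕ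
  weighted k j e = (if mayFollow (suc k) (suc j) true then e else 0)
                 + (if mayFollow (suc k) (suc j) false then e else 0)

  weighted-< : ∀ {k j} e → j < k → weighted k j e ≡ e + e
  weighted-< {k} {j} e j<k rewrite <ᵇ-true (m<n⇒m<1+n j<k) | ≡ᵇ-false j<k = refl

  weighted-≡ : ∀ k e → weighted k k e ≡ e
  weighted-≡ k e rewrite <ᵇ-true (n<1+n k) | ≡ᵇ-refl k = refl

  weighted-> : ∀ {k j} e → k < j → weighted k j e ≡ 0
  weighted-> {k} {j} e k<j rewrite <ᵇ-false k<j = refl

  weighted-sum-> : ∀ n k {M} → suc k ≤′ M →
    sum (applyUpTo (λ j → weighted k j (coeff (largest j) (suc n))) M) ≡ coeff (tails k) (suc n)
  weighted-sum-> n k ≤′-refl = trans (sum-applyUpTo-last _ k) (cong₂ _+_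
    (trans (sum-applyUpTo-cong k (λ j j<k → weighted-< (coeff (largest j) (suc n)) j<k)) (doubled n k))
    (weighted-≡ k (coeff (largest k) (suc n))))
  weighted-sum-> n k (≤′-step {M} k<M) = trans (sum-applyUpTo-last _ M)
    (trans (cong₂ _+_ (weighted-sum-> n k k<M) (weighted-> (coeff (largest M) (suc n)) (≤′⇒≤ k<M)))
      (+-identityʳ _))

  -- If the sum stops short of the size k + 1, every term is doubled, and the sizes it misses are
  -- too large to affect coefficient n + 1.
  weighted-sum : ∀ n k →
    sum (applyUpTo (λ j → weighted k j (coeff (largest j) (suc n))) (suc n)) ≡ coeff (tails k) (suc n)
  weighted-sum n k with ≤-<-connex (suc n) k
  ... | inj₂ k<n = weighted-sum-> n k (≤⇒≤′ k<n)
  ... | inj₁ n<k = begin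
    sum (applyUpTo (λ j → weighted k j (coeff (largest j) (suc n))) (suc n))
      ≡⟨ sum-applyUpTo-cong (suc n) (λ j j≤n → weighted-< (coeff (largest j) (suc n)) (<-≤-trans j≤n n<k)) ⟩
    sum (applyUpTo (λ j → coeff (largest j) (suc n) + coeff (largest j) (suc n)) (suc n))
      ≡⟨ doubled n (suc n) ⟩
    coeff (bounded (suc n)) (suc n)
      ≡⟨ bounded-stable (≤⇒≤′ n<k) ≤-refl ⟨
    coeff (bounded k) (suc n)
      ≡⟨ +-identityʳ _ ⟨
    coeff (bounded k) (suc n) + 0
      ≡⟨ cong (coeff (bounded k) (suc n) +_) (largest-small k n<k) ⟨
    coeff (tails k) (suc n) ∎
    where open ≡-Reasoning

  mutual
    -- A leading part j + 1 leaves the same problem with j for k. The fuel drops by one and the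
    -- total by at least one, so `n ≤ f` persists.
    count-tails : ∀ f n k → n ≤ f → count (tailOf (suc k)) (candidates f n) ≡ coeff (tails k) n
    count-tails f zero k _ = sym (cong₂ _+_ (bounded-stable {k′ = k} (≤⇒≤′ z≤n) z≤n) (largest-small k z≤n))
    count-tails (suc f) (suc n) k (s≤s n≤f) = begin
      count (tailOf (suc k)) (candidates (suc f) (suc n))
        ≡⟨ count-candidates (tailOf (suc k)) f n ⟩
      _ ≡⟨ sum-applyUpTo-cong (suc n) (λ j j<n →
             cong₂ _+_ (count-∷-tails k j true j<n) (count-∷-tails k j false j<n)) ⟩
      sum (applyUpTo (λ j → weighted k j (coeff (largest j) (suc n))) (suc n))
        ≡⟨ weighted-sum n k ⟩
      coeff (tails k) (suc n) ∎
      where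
      open ≡-Reasoning
      count-∷-tails : ∀ k j b → j < suc n →
        count (λ l → tailOf (suc k) ((suc j , b) ∷ l)) (candidates f (n ∸ j)) ≡
        (if mayFollow (suc k) (suc j) b then coeff (largest j) (suc n) else 0)
      count-∷-tails k j b j<n = trans
        (count-∧ˡ (mayFollow (suc k) (suc j) b) (λ l → allowed (suc j) ∧ tailOf (suc j) l)
          (candidates f (n ∸ j)))
        (cong (if mayFollow (suc k) (suc j) b then_else 0) (count-largest f n j n≤f j<n))

    count-largest : ∀ f n j → n ≤ f → j < suc n →
      count (λ l → allowed (suc j) ∧ tailOf (suc j) l) (candidates f (n ∸ j)) ≡ coeff (largest j) (suc n)
    count-largest f n j n≤f (s≤s j≤n) = begin
      count (λ l → allowed (suc j) ∧ tailOf (suc j) l) (candidates f (n ∸ j))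
        ≡⟨ count-∧ˡ (allowed (suc j)) _ (candidates f (n ∸ j)) ⟩
      (if allowed (suc j) then count (tailOf (suc j)) (candidates f (n ∸ j)) else 0)
        ≡⟨ cong (if allowed (suc j) then_else 0) (count-tails f (n ∸ j) j (≤-trans (m∸n≤m n j) n≤f)) ⟩
      (if allowed (suc j) then coeff (tails j) (n ∸ j) else 0)
        ≡⟨ split (allowed (suc j)) (tails j) ⟩
      coeff (if allowed (suc j) then mono (suc j) ⊗ tails j else 𝟘) (suc n)
        ≡⟨ at (largest-tails j) (suc n) ⟨
      coeff (largest j) (suc n) ∎
      where
      open ≡-Reasoning
      split : ∀ b X → (if b then coeff X (n ∸ j) else 0) ≡ coeff (if b then mono (suc j) ⊗ X else 𝟘) (suc n)
      split false X = refl
      split true  X = trans (sym (coeff-mono-≥ j X (n ∸ j)))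
                        (cong (coeff (mono j ⊗ X)) (m+[n∸m]≡n j≤n))

  count-overpartitions : ∀ n →
    count (λ l → isOverpartition l ∧ allAllowed l) (candidates n n) ≡ coeff (bounded n) n
  count-overpartitions zero    = refl
  count-overpartitions (suc n) = begin
    count good (candidates (suc n) (suc n))
      ≡⟨ count-candidates good n n ⟩
    _ ≡⟨ sum-applyUpTo-cong (suc n) (λ j j<n →
           cong₂ _+_ (count-∷-good j true j<n) (count-∷-good j false j<n)) ⟩
    sum (applyUpTo (λ j → coeff (largest j) (suc n) + coeff (largest j) (suc n)) (suc n))
      ≡⟨ doubled n (suc n) ⟩
    coeff (bounded (suc n)) (suc n) ∎
    where
    open ≡-Reasoning
    good : List Part → Bool
    good l = isOverpartition l ∧ allAllowed l
    count-∷-good : ∀ j b → j < suc n →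
      count (λ l → good ((suc j , b) ∷ l)) (candidates n (n ∸ j)) ≡ coeff (largest j) (suc n)
    count-∷-good j b j<n = trans
      (count-cong (overpartition-∷ (suc j) b) (candidates n (n ∸ j)))
      (count-largest n n j ≤-refl j<n)

-- Dilation q ↦ q²

dilate : (ℕ → ℕ) → ℕ → ℕ
dilate f zero          = f 0
dilate f (suc zero)    = 0
dilate f (suc (suc n)) = dilate (λ i → f (suc i)) n

dilation : Series → Series
coeff (dilation X) = dilate (coeff X)

-- In the form `n * 2` the double grows by two visible successors, in step with `dilate`.
dilate-even : ∀ f n → dilate f (n * 2) ≡ f n
dilate-even f zero    = refl
dilate-even f (suc n) = dilate-even (λ i → f (suc i)) n

dilate-odd : ∀ f n → dilate f (suc (n * 2)) ≡ 0
dilate-odd f zero    = refl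
dilate-odd f (suc n) = dilate-odd (λ i → f (suc i)) n

dilate-cong : ∀ {f g} → (∀ i → f i ≡ g i) → ∀ n → dilate f n ≡ dilate g n
dilate-cong p zero          = p 0
dilate-cong p (suc zero)    = refl
dilate-cong p (suc (suc n)) = dilate-cong (λ i → p (suc i)) n

dilate-zero : ∀ n → dilate (λ _ → 0) n ≡ 0
dilate-zero zero          = refl
dilate-zero (suc zero)    = refl
dilate-zero (suc (suc n)) = dilate-zero n

dilate-+ : ∀ f g n → dilate (λ i → f i + g i) n ≡ dilate f n + dilate g n
dilate-+ f g zero          = refl
dilate-+ f g (suc zero)    = refl
dilate-+ f g (suc (suc n)) = dilate-+ (λ i → f (suc i)) (λ i → g (suc i)) n

dilation-cong : ∀ {X Y} → X ≈ Y → dilation X ≈ dilation Y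
dilation-cong p = pointwise (dilate-cong (at p))

dilation-⊕ : ∀ X Y → dilation (X ⊕ Y) ≈ dilation X ⊕ dilation Y
dilation-⊕ X Y = pointwise (dilate-+ (coeff X) (coeff Y))

dilation-𝟙 : dilation 𝟙 ≈ 𝟙
dilation-𝟙 = pointwise λ
  { zero          → refl
  ; (suc zero)    → refl
  ; (suc (suc n)) → dilate-zero n }

dilation-shift : ∀ X → dilation (shift X) ≈ shift (shift (dilation X))
dilation-shift X = pointwise λ
  { zero          → refl
  ; (suc zero)    → refl
  ; (suc (suc n)) → refl }

dilation-mono : ∀ k X → dilation (mono k ⊗ X) ≈ mono (2 * k) ⊗ dilation X
dilation-mono zero    X = ≈-trans (dilation-cong (𝟙-identityˡ X)) (≈-sym (𝟙-identityˡ _))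
dilation-mono (suc k) X = begin
  dilation (mono (suc k) ⊗ X)                   ≈⟨ dilation-cong (shift-⊗ (mono k) X) ⟩
  dilation (shift (mono k ⊗ X))                 ≈⟨ dilation-shift (mono k ⊗ X) ⟩
  shift (shift (dilation (mono k ⊗ X)))         ≈⟨ shift-cong (shift-cong (dilation-mono k X)) ⟩
  shift (shift (mono (2 * k) ⊗ dilation X))     ≈⟨ shift-cong (shift-⊗ (mono (2 * k)) _) ⟨
  shift (mono (suc (2 * k)) ⊗ dilation X)       ≈⟨ shift-⊗ (mono (suc (2 * k))) _ ⟨
  mono (2 + 2 * k) ⊗ dilation X                 ≡⟨ cong (λ e → mono e ⊗ dilation X) (*-suc 2 k) ⟨
  mono (2 * suc k) ⊗ dilation X                 ∎
  where open ≈-Reasoning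

-- Dilation turns the recurrence of step q^(k+1) that defines the quotient into one of step
-- q^(2k+2), and uniqueness identifies its solution.
dilation-overFactor : ∀ k X → dilation (overFactor (suc k) ⊗ X) ≈ overFactor (2 * suc k) ⊗ dilation X
dilation-overFactor k X = begin
  dilation (overFactor (suc k) ⊗ X)
    ≈⟨ dilation-cong (overFactor-expand (mono (suc k)) (geo (suc k)) X) ⟩
  dilation (geo (suc k) ⊗ X ⊕ mono (suc k) ⊗ (geo (suc k) ⊗ X))
    ≈⟨ dilation-⊕ _ _ ⟩
  dilation (geo (suc k) ⊗ X) ⊕ dilation (mono (suc k) ⊗ (geo (suc k) ⊗ X))
    ≈⟨ ⊕-cong dilation-geo (≈-trans (dilation-mono (suc k) _) (⊗-congˡ dilation-geo)) ⟩
  geo (2 * suc k) ⊗ dilation X ⊕ mono (2 * suc k) ⊗ (geo (2 * suc k) ⊗ dilation X)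
    ≈⟨ overFactor-expand (mono (2 * suc k)) (geo (2 * suc k)) (dilation X) ⟨
  overFactor (2 * suc k) ⊗ dilation X ∎
  where
  open ≈-Reasoning
  dilation-geo : dilation (geo (suc k) ⊗ X) ≈ geo (2 * suc k) ⊗ dilation X
  dilation-geo = geo-unique (2 * suc k) (≈-trans (dilation-cong (geo-unfold-⊗ (suc k) X))
    (≈-trans (dilation-⊕ X _) (⊕-congˡ (dilation-mono (suc k) _))))

-- The generating functions of the two families of overpartitions

odd? : ℕ → Bool
odd? k = k % 2 ≡ᵇ 1

module All = Restricted (λ _ → true)
module Odd = Restricted odd?

pbar-bounded : ∀ n → pbar n ≡ coeff (All.bounded n) n
pbar-bounded n = trans
  (count-cong
    (λ l → sym (trans (cong (isOverpartition l ∧_) (allAllowed-true l)) (∧-identityʳ _)))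
    (candidates n n))
  (All.count-overpartitions n)
  where
  allAllowed-true : ∀ l → All.allAllowed l ≡ true
  allAllowed-true []      = refl
  allAllowed-true (_ ∷ l) = allAllowed-true l

pbarOdd-bounded : ∀ n → pbarOdd n ≡ coeff (Odd.bounded n) n
pbarOdd-bounded n = begin
  pbarOdd n
    ≡⟨ count-filterᵇ isOverpartition allOdd (candidates n n) ⟩
  count (λ l → isOverpartition l ∧ allOdd l) (candidates n n)
    ≡⟨ count-cong (λ l → cong (isOverpartition l ∧_) (allOdd-allAllowed l)) (candidates n n) ⟩
  count (λ l → isOverpartition l ∧ Odd.allAllowed l) (candidates n n)
    ≡⟨ Odd.count-overpartitions n ⟩
  coeff (Odd.bounded n) n ∎
  where
  open ≡-Reasoning
  allOdd-allAllowed : ∀ l → allOdd l ≡ Odd.allAllowed l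
  allOdd-allAllowed []            = refl
  allOdd-allAllowed ((a , _) ∷ l) = cong (odd? a ∧_) (allOdd-allAllowed l)

odd?-odd : ∀ n → odd? (suc (n * 2)) ≡ true
odd?-odd zero    = refl
odd?-odd (suc n) = odd?-odd n

odd?-even : ∀ n → odd? (n * 2) ≡ false
odd?-even zero    = refl
odd?-even (suc n) = odd?-even n

oddOver-bounded : ∀ n → Odd.bounded (n * 2) ≈ oddOver n
oddOver-bounded zero    = ≈-refl
oddOver-bounded (suc n) rewrite odd?-even (suc n) | odd?-odd n = ⊗-cong
  (≈-reflexive (cong (λ e → overFactor (suc e)) (*-comm n 2))) (oddOver-bounded n)

evenOver-bounded : ∀ n → evenOver n ≈ dilation (All.bounded n)
evenOver-bounded zero    = ≈-sym dilation-𝟙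
evenOver-bounded (suc n) = ≈-trans (⊗-congˡ (evenOver-bounded n)) (≈-sym (dilation-overFactor n _))

-- Extraction of the odd coefficients

sumTo : (ℕ → Series) → ℕ → Series
sumTo f zero    = 𝟘
sumTo f (suc n) = sumTo f n ⊕ f n

sumTo-first : ∀ f n → sumTo f (suc n) ≈ f 0 ⊕ sumTo (λ k → f (suc k)) n
sumTo-first f zero    = ⊕-comm 𝟘 (f 0)
sumTo-first f (suc n) = ≈-trans (⊕-congʳ (sumTo-first f n)) (⊕-assoc _ _ _)

-- The indices r < b give the squares b², ..., 1², the remaining ones 0², ..., n².
antidiagonal-centered : ∀ b n → antidiagonal (b + n) (λ r _ → shiftedSquare b r) ≈
                                sumTo (λ j → square (suc j)) b ⊕ sumTo square (suc n)
antidiagonal-centered (suc b) n = begin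
  square (suc b) ⊕ antidiagonal (b + n) (λ r _ → shiftedSquare b r)
    ≈⟨ ⊕-congˡ (antidiagonal-centered b n) ⟩
  square (suc b) ⊕ (sumTo (λ j → square (suc j)) b ⊕ sumTo square (suc n))
    ≈⟨ solve 3 (λ a b c → a :+ (b :+ c) := (b :+ a) :+ c) ≈-refl (square (suc b))
         (sumTo (λ j → square (suc j)) b) (sumTo square (suc n)) ⟩
  sumTo (λ j → square (suc j)) (suc b) ⊕ sumTo square (suc n) ∎
  where open ≈-Reasoning
antidiagonal-centered zero n = ≈-trans (one-sided n) (≈-sym (⊕-identityˡ _))
  where
  one-sided : ∀ n → antidiagonal n (λ r _ → shiftedSquare 0 r) ≈ sumTo square (suc n)
  one-sided zero    = ≈-sym (⊕-identityˡ _)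
  one-sided (suc n) = ≈-trans (antidiagonal-last n (λ r _ → shiftedSquare 0 r)) (⊕-congʳ (one-sided n))

-- A second term for j = 0 turns the two-sided sum into twice a one-sided one. Being an even square,
-- it adds nothing to odd coefficients.
theta-double : ∀ n → square 0 ⊕ theta n ≈ sumTo square (suc n) ⊕ sumTo square (suc n)
theta-double n = begin
  square 0 ⊕ theta n
    ≈⟨ ⊕-congˡ (antidiagonal-centered n n) ⟩
  square 0 ⊕ (sumTo (λ j → square (suc j)) n ⊕ sumTo square (suc n))
    ≈⟨ ⊕-assoc _ _ _ ⟨
  (square 0 ⊕ sumTo (λ j → square (suc j)) n) ⊕ sumTo square (suc n)
    ≈⟨ ⊕-congʳ (sumTo-first square n) ⟨
  sumTo square (suc n) ⊕ sumTo square (suc n) ∎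
  where open ≈-Reasoning

module _ (n : ℕ) (X : Series) where

  square-even : ∀ k → coeff (square (k * 2) ⊗ dilation X) (suc (n * 2)) ≡ 0
  square-even k = begin
    coeff (square (k * 2) ⊗ dilation X) (suc (n * 2))
      ≡⟨ cong (λ e → coeff (mono e ⊗ dilation X) (suc (n * 2))) (exponent k) ⟩
    coeff (mono (2 * (2 * k * k)) ⊗ dilation X) (suc (n * 2))
      ≡⟨ at (dilation-mono (2 * k * k) X) (suc (n * 2)) ⟨
    coeff (dilation (mono (2 * k * k) ⊗ X)) (suc (n * 2))
      ≡⟨ dilate-odd _ n ⟩
    0 ∎
    where
    open ≡-Reasoning
    exponent : ∀ k → k * 2 * (k * 2) ≡ 2 * (2 * k * k)
    exponent = solve-∀

  square-odd : ∀ k → coeff (square (suc (k * 2)) ⊗ dilation X) (suc (n * 2)) ≡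
                     coeff (mono (2 * k * (k + 1)) ⊗ X) n
  square-odd k = begin
    coeff (square (suc (k * 2)) ⊗ dilation X) (suc (n * 2))
      ≡⟨ cong (λ e → coeff (mono e ⊗ dilation X) (suc (n * 2))) (exponent k) ⟩
    coeff (mono (2 * (2 * k * (k + 1))) ⊗ dilation X) (n * 2)
      ≡⟨ at (dilation-mono (2 * k * (k + 1)) X) (n * 2) ⟨
    coeff (dilation (mono (2 * k * (k + 1)) ⊗ X)) (n * 2)
      ≡⟨ dilate-even _ n ⟩
    coeff (mono (2 * k * (k + 1)) ⊗ X) n ∎
    where
    open ≡-Reasoning
    exponent : ∀ k → suc (k * 2) * suc (k * 2) ≡ suc (2 * (2 * k * (k + 1)))
    exponent = solve-∀

  sumTo-square : ∀ k → coeff (sumTo square (k * 2) ⊗ dilation X) (suc (n * 2)) ≡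
                       sum (applyUpTo (λ i → coeff (mono (2 * i * (i + 1)) ⊗ X) n) k)
  sumTo-square zero    = at (⊗-zeroˡ (dilation X)) (suc (n * 2))
  sumTo-square (suc k) = begin
    coeff ((S ⊕ square (k * 2) ⊕ square (suc (k * 2))) ⊗ E) m
      ≡⟨ at (solve 4 (λ s a b e → (s :+ a :+ b) :* e := s :* e :+ a :* e :+ b :* e) ≈-refl
              S (square (k * 2)) (square (suc (k * 2))) E) m ⟩
    coeff (S ⊗ E) m + coeff (square (k * 2) ⊗ E) m + coeff (square (suc (k * 2)) ⊗ E) m
      ≡⟨ cong₂ _+_ (cong₂ _+_ (sumTo-square k) (square-even k)) (square-odd k) ⟩
    sum (applyUpTo term k) + 0 + term k
      ≡⟨ cong (_+ term k) (+-identityʳ _) ⟩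
    sum (applyUpTo term k) + term k
      ≡⟨ sum-applyUpTo-last term k ⟨
    sum (applyUpTo term (suc k)) ∎
    where
    open ≡-Reasoning
    S = sumTo square (k * 2)
    E = dilation X
    m = suc (n * 2)
    term : ℕ → ℕ
    term i = coeff (mono (2 * i * (i + 1)) ⊗ X) n

  -- With the odd cut-off 2k + 1 the squares 0², ..., (2k + 1)² fall into k + 1 pairs of one even
  -- and one odd square.
  theta-odd : ∀ k → coeff (theta (suc (k * 2)) ⊗ dilation X) (suc (n * 2)) ≡
                    2 * sum (applyUpTo (λ i → coeff (mono (2 * i * (i + 1)) ⊗ X) n) (suc k))
  theta-odd k = begin
    coeff (θ ⊗ E) m
      ≡⟨ cong (_+ coeff (θ ⊗ E) m) (square-even 0) ⟨
    coeff (square 0 ⊗ E ⊕ θ ⊗ E) m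
      ≡⟨ at (⊗-distribʳ-⊕ E (square 0) θ) m ⟨
    coeff ((square 0 ⊕ θ) ⊗ E) m
      ≡⟨ at (⊗-congʳ {E} (theta-double (suc (k * 2)))) m ⟩
    coeff ((S ⊕ S) ⊗ E) m
      ≡⟨ at (⊗-distribʳ-⊕ E S S) m ⟩
    coeff (S ⊗ E) m + coeff (S ⊗ E) m
      ≡⟨ cong (coeff (S ⊗ E) m +_) (+-identityʳ _) ⟨
    2 * coeff (S ⊗ E) m
      ≡⟨ cong (2 *_) (sumTo-square (suc k)) ⟩
    2 * sum (applyUpTo (λ i → coeff (mono (2 * i * (i + 1)) ⊗ X) n) (suc k)) ∎
    where
    open ≡-Reasoning
    θ = theta (suc (k * 2))
    S = sumTo square (suc k * 2)
    E = dilation X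
    m = suc (n * 2)

≤ᵇ-true : ∀ {m n} → m ≤ n → (m ≤ᵇ n) ≡ true
≤ᵇ-true {zero}  _   = refl
≤ᵇ-true {suc m} m<n = <ᵇ-true m<n

≤ᵇ-false : ∀ {m n} → n < m → (m ≤ᵇ n) ≡ false
≤ᵇ-false (s≤s n≤m) = <ᵇ-false n≤m

pbarSub-coeff : ∀ {N n} → n ≤ N → ∀ e → coeff (mono e ⊗ All.bounded N) n ≡ pbarSub n e
pbarSub-coeff {N} {n} n≤N e with ≤-<-connex e n
... | inj₂ n<e rewrite ≤ᵇ-false n<e = coeff-mono-< (All.bounded N) n<e
... | inj₁ e≤n rewrite ≤ᵇ-true e≤n = begin
  coeff (mono e ⊗ All.bounded N) n
    ≡⟨ cong (coeff (mono e ⊗ All.bounded N)) (m+[n∸m]≡n e≤n) ⟨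
  coeff (mono e ⊗ All.bounded N) (e + (n ∸ e))
    ≡⟨ coeff-mono-≥ e (All.bounded N) (n ∸ e) ⟩
  coeff (All.bounded N) (n ∸ e)
    ≡⟨ All.bounded-stable (≤⇒≤′ (≤-trans (m∸n≤m n e) n≤N)) ≤-refl ⟩
  coeff (All.bounded (n ∸ e)) (n ∸ e)
    ≡⟨ pbar-bounded (n ∸ e) ⟨
  pbar (n ∸ e) ∎
  where open ≡-Reasoning

theorem3p6 : (n : ℕ) → pbarOdd (2 * n + 1) ≡ 2 * thetaSum n
theorem3p6 n = begin
  pbarOdd (2 * n + 1)
    ≡⟨ cong pbarOdd (trans (+-comm (2 * n) 1) (cong suc (*-comm 2 n))) ⟩
  pbarOdd m
    ≡⟨ pbarOdd-bounded m ⟩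
  coeff (Odd.bounded m) m
    -- `oddOver-bounded` concerns even bounds, so m is raised to 2m; parts above m cannot affect
    -- coefficient m.
    ≡⟨ Odd.bounded-stable (≤⇒≤′ (m≤m*n m 2)) ≤-refl ⟨
  coeff (Odd.bounded (m * 2)) m
    ≡⟨ at (oddOver-bounded m) m ⟩
  coeff (oddOver m) m
    ≡⟨ at< (oddOver≈theta m) m (s≤s (m≤n*m m 2)) ⟩
  coeff (theta m ⊗ evenOver m) m
    ≡⟨ at (⊗-congˡ {theta m} (evenOver-bounded m)) m ⟩
  coeff (theta m ⊗ dilation (All.bounded m)) m
    ≡⟨ theta-odd n (All.bounded m) n ⟩
  2 * sum (applyUpTo (λ k → coeff (mono (2 * k * (k + 1)) ⊗ All.bounded m) n) (suc n))
    ≡⟨ cong (2 *_) (sum-applyUpTo-cong (suc n) (λ k _ → pbarSub-coeff n≤m (2 * k * (k + 1)))) ⟩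
  2 * sum (applyUpTo (λ k → pbarSub n (2 * k * (k + 1))) (suc n))
    ≡⟨ cong (λ l → 2 * sum l) (map-upTo (λ k → pbarSub n (2 * k * (k + 1))) (suc n)) ⟨
  2 * thetaSum n ∎
  where
  open ≡-Reasoning
  m = suc (n * 2)
  n≤m : n ≤ m
  n≤m = m≤n⇒m≤1+n (m≤m*n n 2)
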